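{- The strategies $(A1)$, $(A2)$, $(A3)$, $(A1')$, $(A2')$, $(A3')$ for Alice are not optimal for all complete multipartite graphs: there exists a complete multipartite graph $G$ such that none of these six strategies (whenever applicable to $G$) is a winning strategy for Alice in the graph coloring game on $G$ with exactly $\chi_g(G)$ colors.
   Context: Graph coloring game: given a graph $G$ and a finite set $C$ of colors, Alice and Bob alternately (Alice first) pick an uncolored vertex and give it a legal color, i.e. a color from $C$ not used on any neighbor. The game ends when all vertices are colored (Alice wins) or when no uncolored vertex has a legal color (Bob wins). The game chromatic number $\chi_g(G)$ is the minimum $|C|$ for which Alice has a winning strategy. A strategy for Alice (possibly leaving some choices free) is winning if in every play in which Alice follows it, the whole graph gets colored. $K_{r_1,\ldots,r_k}$ denotes the complete $k$-partite graph with parts (independent sets) $V_1,\ldots,V_k$, $|V_i|=r_i\ge1$, $r_1\ge\cdots\ge r_k$, every two vertices in different parts adjacent; the paper assumes that if $k\ge2$ then $r_1\ge 2$; $n=\sum_i r_i$. A part is uncolored / partially colored / fully colored if none / some but not all / all of its vertices are colored; a singleton is a part of size $1$. A "new color" is a color of $C$ not yet used on any vertex. Strategy $(A1)$: if there is an uncolored part, pick any vertex of any uncolored part and assign a new color; otherwise pick any uncolored vertex in a partially colored part $V_i$ and give it a color already used in $V_i$. Strategy $(A2)$ (for a fixed $j$ with $r_j=3$): (1) first move: color a vertex of $V_j$ with a new color; (2) otherwise, if Bob's last move was in $V_j$, color another uncolored vertex of $V_j$ with the color Bob just used; (3) otherwise, if there is an uncolored part, color any vertex of one with a new color; (4) otherwise,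 color any uncolored vertex of a partially colored part $V_i$ with a color already used in $V_i$. Strategy $(A3)$ (for $n$ odd): (1) first move: color a vertex of a part of smallest odd size with a new color; (2) otherwise, if Bob's last move was in a partially colored part $V_i$, color another uncolored vertex of $V_i$ with the color Bob just used; (3) otherwise, if there is a partially colored part $V_i$, color any uncolored vertex of it with a color already used in $V_i$; (4) otherwise, color any vertex of an uncolored part of smallest odd size with a new color. Strategies $(A1')$, $(A2')$, $(A3')$ are obtained from $(A1)$, $(A2)$, $(A3)$ respectively by adding the rule "if there is an uncolored singleton, color it with a new color", with the highest priority in $(A1')$ and $(A3')$, and in $(A2')$ with priority just below rules (1) and (2) of $(A2)$ (those forcing Alice to play in $V_j$). -}

module Defs where

open import Data.Nat using (ℕ; zero; suc; _+_; _*_; _≤_; _<_)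
open import Data.Fin using (Fin; toℕ) renaming (_≤_ to _≤ᶠ_)
import Data.Fin.Properties as FinP
open import Data.Maybe using (Maybe; just; nothing)
open import Data.Product using (Σ; ∃; ∃-syntax; _×_; _,_; proj₁; proj₂)
open import Data.Product.Properties using (≡-dec)
open import Data.Sum using (_⊎_)
open import Data.Empty using (⊥)
open import Data.List using (List; []; _∷_; tabulate)
open import Data.Nat.ListAction using (sum)
open import Relation.Nullary using (¬_; yes; no)
open import Relation.Binary.PropositionalEquality using (_≡_; _≢_)

Odd : ℕ → Set
Odd n = ∃[ m ] n ≡ suc (2 * m)

-- Complete multipartite graph K_{r_1,...,r_k}: k parts, part i has
-- r i vertices; the paper's standing assumptions on the sizes.

IsPartSizes : (k : ℕ) → (Fin k → ℕ) → Set
IsPartSizes k r =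
  (∀ i → 1 ≤ r i)
  × (∀ i j → i ≤ᶠ j → r j ≤ r i)
  × (2 ≤ k → ∀ i → toℕ i ≡ 0 → 2 ≤ r i)

order : (k : ℕ) → (Fin k → ℕ) → ℕ
order k r = sum (tabulate r)

module Game (k : ℕ) (r : Fin k → ℕ) (c : ℕ) where

  Vertex : Set
  Vertex = Σ (Fin k) (λ i → Fin (r i))

  part : Vertex → Fin k
  part = proj₁

  Adj : Vertex → Vertex → Set
  Adj v w = part v ≢ part w

  Color : Set
  Color = Fin c

  Coloring : Set
  Coloring = Vertex → Maybe Color

  empty : Coloring
  empty _ = nothing

  _≟V_ : (v w : Vertex) → Relation.Nullary.Dec (v ≡ w)
  _≟V_ = ≡-dec FinP._≟_ FinP._≟_

  update : Coloring → Vertex → Color → Coloring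
  update κ v col w with w ≟V v
  ... | yes _ = just col
  ... | no  _ = κ w

  Full : Coloring → Set
  Full κ = ∀ v → κ v ≢ nothing

  Legal : Coloring → Vertex → Color → Set
  Legal κ v col = κ v ≡ nothing × (∀ w → Adj v w → κ w ≢ just col)

  -- Alice has a winning strategy (the game tree, Alice moves first).
  -- A position with Alice to move; the game ends with Alice's win when
  -- all vertices are coloured, and with Bob's win when some vertex is
  -- uncoloured but no legal move exists.

  mutual
    data AliceWins : Coloring → Set where
      doneA : ∀ {κ} → Full κ → AliceWins κ
      moveA : ∀ {κ} v col → Legal κ v col → BobLoses (update κ v col) →
              AliceWins κ

    data BobLoses : Coloring → Set where
      doneB : ∀ {κ} → Full κ → BobLoses κ
      moveB : ∀ {κ} → (∃[ v ] ∃[ col ] Legal κ v col) →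
              (∀ v col → Legal κ v col → AliceWins (update κ v col)) →
              BobLoses κ

  -- Strategies for Alice (possibly leaving choices free): given the
  -- current colouring and Bob's last move (nothing before Alice's first
  -- move), a predicate on the moves (v , col) Alice may make.

  Strategy : Set₁
  Strategy = Coloring → Maybe Vertex → Vertex → Color → Set

  -- Plays in which Alice follows S all end with the whole graph coloured.
  -- If S offers Alice no legal move in a non-final position, she cannot
  -- follow S, and S is not winning.
  mutual
    data SWins (S : Strategy) : Coloring → Maybe Vertex → Set where
      doneS : ∀ {κ last} → Full κ → SWins S κ last
      moveS : ∀ {κ last} →
              (∃[ v ] ∃[ col ] (Legal κ v col × S κ last v col)) →
              (∀ v col → Legal κ v col → S κ last v col →
                 SBobLoses S (update κ v col)) →
              SWins S κ last

    data SBobLoses (S : Strategy) : Coloring → Set where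
      doneSB : ∀ {κ} → Full κ → SBobLoses S κ
      moveSB : ∀ {κ} → (∃[ v ] ∃[ col ] Legal κ v col) →
               (∀ v col → Legal κ v col → SWins S (update κ v col) (just v)) →
               SBobLoses S κ

  IsWinning : Strategy → Set
  IsWinning S = SWins S empty nothing

  -- Prioritised rule lists.  A rule describes the moves it prescribes;
  -- a rule applies when it prescribes at least one legal move, and
  -- "otherwise" passes to the next rule.

  Rule : Set₁
  Rule = Strategy

  Applies : Rule → Coloring → Maybe Vertex → Set
  Applies R κ last = ∃[ v ] ∃[ col ] (Legal κ v col × R κ last v col)

  byRules : List Rule → Strategy
  byRules [] κ last v col = ⊥
  byRules (R ∷ Rs) κ last v col =
    (Applies R κ last × R κ last v col)
    ⊎ (¬ Applies R κ last × byRules Rs κ last v col)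

  Colored : Coloring → Vertex → Set
  Colored κ v = κ v ≢ nothing

  PartUncolored : Coloring → Fin k → Set
  PartUncolored κ i = ∀ a → κ (i , a) ≡ nothing

  PartPartial : Coloring → Fin k → Set
  PartPartial κ i = (∃[ a ] Colored κ (i , a)) × (∃[ a ] κ (i , a) ≡ nothing)

  NewColor : Coloring → Color → Set
  NewColor κ col = ∀ w → κ w ≢ just col

  UsedIn : Coloring → Fin k → Color → Set
  UsedIn κ i col = ∃[ a ] κ (i , a) ≡ just col

  FirstMove : Coloring → Set
  FirstMove κ = ∀ w → κ w ≡ nothing

  SmallestOdd : (Fin k → Set) → Fin k → Set
  SmallestOdd P i = P i × Odd (r i) × (∀ j → P j → Odd (r j) → r i ≤ r j)

  BobLastIn : Maybe Vertex → Fin k → Vertex → Set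
  BobLastIn last i w = last ≡ just w × part w ≡ i

  ruleUncoloredPart : Rule
  ruleUncoloredPart κ last v col = PartUncolored κ (part v) × NewColor κ col

  rulePartialPart : Rule
  rulePartialPart κ last v col = PartPartial κ (part v) × UsedIn κ (part v) col

  ruleSingleton : Rule
  ruleSingleton κ last v col = r (part v) ≡ 1 × NewColor κ col

  ruleA2first : Fin k → Rule
  ruleA2first j κ last v col = FirstMove κ × part v ≡ j × NewColor κ col

  ruleA2answer : Fin k → Rule
  ruleA2answer j κ last v col =
    ∃[ w ] (BobLastIn last j w × part v ≡ j × κ w ≡ just col)

  ruleA3first : Rule
  ruleA3first κ last v col =
    FirstMove κ × SmallestOdd (λ _ → Data.Unit.⊤) (part v) × NewColor κ col
    where import Data.Unit

  ruleA3answer : Rule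
  ruleA3answer κ last v col =
    ∃[ w ] (BobLastIn last (part v) w × PartPartial κ (part v) × κ w ≡ just col)

  ruleA3fresh : Rule
  ruleA3fresh κ last v col =
    SmallestOdd (PartUncolored κ) (part v) × NewColor κ col

  A1 : Strategy
  A1 = byRules (ruleUncoloredPart ∷ rulePartialPart ∷ [])

  A2 : Fin k → Strategy
  A2 j = byRules (ruleA2first j ∷ ruleA2answer j ∷ ruleUncoloredPart
                   ∷ rulePartialPart ∷ [])

  A3 : Strategy
  A3 = byRules (ruleA3first ∷ ruleA3answer ∷ rulePartialPart ∷ ruleA3fresh ∷ [])

  A1' : Strategy
  A1' = byRules (ruleSingleton ∷ ruleUncoloredPart ∷ rulePartialPart ∷ [])

  A2' : Fin k → Strategy
  A2' j = byRules (ruleA2first j ∷ ruleA2answer j ∷ ruleSingleton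
                    ∷ ruleUncoloredPart ∷ rulePartialPart ∷ [])

  A3' : Strategy
  A3' = byRules (ruleSingleton ∷ ruleA3first ∷ ruleA3answer ∷ rulePartialPart
                  ∷ ruleA3fresh ∷ [])

IsGameChromaticNumber : (k : ℕ) → (Fin k → ℕ) → ℕ → Set
IsGameChromaticNumber k r c =
  Game.AliceWins k r c (Game.empty k r c)
  × (∀ c' → c' < c → ¬ Game.AliceWins k r c' (Game.empty k r c'))

{-# OPTIONS --safe #-}

-- The graph is K_{2,1,1,1,1}, that is K_6 minus an edge, with five colors.
-- Four of the colors are needed by the singletons, so Alice wins exactly when
-- the two vertices of V_1 receive the same color.  She achieves this by opening
-- with a singleton, answering singletons by singletons, and answering a move
-- in V_1 by repeating its color in V_1; parity leaves V_1 to the last two moves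
-- if Bob never enters it.  Strategy (A1) may open in V_1 and (A1') never answers
-- in V_1 as long as a singleton is left; both let Bob use two colors in V_1.
-- No part has size 3 and the order is even, so the other strategies do not apply.

module Submission where

open import Defs
open import Data.Nat using (ℕ; zero; suc; _≤_; z≤n; s≤s)
open import Data.Nat.Properties using (≤-refl; <⇒≱; even≢odd)
open import Data.Fin using (Fin; zero; suc; #_) renaming (_≤_ to _≤ᶠ_)
open import Data.Fin.Properties using (all?; any?; injective⇒≤) renaming (_≟_ to _≟ᶠ_)
open import Data.List using (_∷_)
open import Data.Maybe using (Maybe; just; nothing)
import Data.Maybe.Properties as MaybeP
open import Data.Product using (Σ; ∃-syntax; _×_; _,_; proj₁; proj₂)
open import Data.Sum using (inj₁)
open import Data.Empty using (⊥-elim)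
open import Function using (_∘_)
open import Relation.Nullary using (¬_; Dec; yes; no)
open import Relation.Nullary.Decidable using (True; False; toWitness; toWitnessFalse; map′; ¬?; _×-dec_; _→-dec_; decidable-stable)
open import Relation.Unary using (Decidable)
open import Relation.Binary.PropositionalEquality using (_≡_; _≢_; refl; sym; trans; cong)

module GameProperties (k : ℕ) (r : Fin k → ℕ) (c : ℕ) where

  open Game k r c

  _≟C_ : (x y : Maybe Color) → Dec (x ≡ y)
  _≟C_ = MaybeP.≡-dec _≟ᶠ_

  allV? : ∀ {P : Vertex → Set} → Decidable P → Dec (∀ v → P v)
  allV? P? = map′ (λ f (i , a) → f i a) (λ f i a → f (i , a))
                  (all? λ i → all? λ a → P? (i , a))

  anyV? : ∀ {P : Vertex → Set} → Decidable P → Dec (∃[ v ] P v)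
  anyV? P? = map′ (λ (i , a , p) → (i , a) , p) (λ ((i , a) , p) → i , a , p)
                  (any? λ i → any? λ a → P? (i , a))

  Full? : Decidable Full
  Full? κ = allV? λ v → ¬? (κ v ≟C nothing)

  Legal? : ∀ κ v col → Dec (Legal κ v col)
  Legal? κ v col =
    κ v ≟C nothing ×-dec
    allV? λ w → ¬? (part v ≟ᶠ part w) →-dec ¬? (κ w ≟C just col)

  NewColor? : ∀ κ col → Dec (NewColor κ col)
  NewColor? κ col = allV? λ w → ¬? (κ w ≟C just col)

  LegalMove : Coloring → Set
  LegalMove κ = ∃[ v ] ∃[ col ] Legal κ v col

  LegalMove? : Decidable LegalMove
  LegalMove? κ = anyV? λ v → any? λ col → Legal? κ v col

  -- Only whole rounds are counted: a win in which Alice makes the last move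
  -- (odd order) is not captured.
  WinsInRounds : ℕ → Coloring → Set
  AnswersInRounds : ℕ → Coloring → Set

  WinsInRounds zero    κ = Full κ
  WinsInRounds (suc n) κ =
    ∃[ v ] ∃[ col ] (Legal κ v col × AnswersInRounds n (update κ v col))

  AnswersInRounds n κ =
    LegalMove κ × (∀ v col → Legal κ v col → WinsInRounds n (update κ v col))

  winsInRounds? : ∀ n → Decidable (WinsInRounds n)
  answersInRounds? : ∀ n → Decidable (AnswersInRounds n)

  winsInRounds? zero    κ = Full? κ
  winsInRounds? (suc n) κ = anyV? λ v → any? λ col →
    Legal? κ v col ×-dec answersInRounds? n (update κ v col)

  answersInRounds? n κ = LegalMove? κ ×-dec allV? λ v → all? λ col →
    Legal? κ v col →-dec winsInRounds? n (update κ v col)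

  -- With the number of rounds fixed, the game tree is finite and searchable, so this turns a
  -- computed answer into a win for Alice.
  winsInRounds⇒AliceWins : ∀ n {κ} → WinsInRounds n κ → AliceWins κ
  winsInRounds⇒AliceWins zero    full = doneA full
  winsInRounds⇒AliceWins (suc n) (v , col , legal , move , answer) =
    moveA v col legal (moveB move λ w col′ legal′ →
      winsInRounds⇒AliceWins n (answer w col′ legal′))

  Proper : Coloring → Set
  Proper κ = ∀ v w col → Adj v w → κ v ≡ just col → κ w ≢ just col

  empty-proper : Proper empty
  empty-proper v w col adj ()

  update-proper : ∀ {κ} v col → Legal κ v col → Proper κ → Proper (update κ v col)
  update-proper v col (_ , free) proper x y col′ adj eqx eqy
    with x ≟V v | y ≟V v
  update-proper v col (_ , free) proper x y col′ adj eqx eqy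
    | yes refl | yes refl = adj refl
  update-proper v col (_ , free) proper x y col′ adj refl eqy
    | yes refl | no _ = free y adj eqy
  update-proper v col (_ , free) proper x y col′ adj eqx refl
    | no _ | yes refl = free x (adj ∘ sym) eqx
  update-proper v col (_ , free) proper x y col′ adj eqx eqy
    | no _ | no _ = proper x y col′ adj eqx eqy

  -- Follow a single play to its end, letting Bob make the move that `moveB` exhibits; legal moves
  -- preserve properness.
  AliceWins⇒fullProper : ∀ {κ} → AliceWins κ → Proper κ → ∃[ κ′ ] (Full κ′ × Proper κ′)
  BobLoses⇒fullProper : ∀ {κ} → BobLoses κ → Proper κ → ∃[ κ′ ] (Full κ′ × Proper κ′)

  AliceWins⇒fullProper (doneA full) proper = _ , full , proper
  AliceWins⇒fullProper (moveA v col legal next) proper =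
    BobLoses⇒fullProper next (update-proper v col legal proper)

  BobLoses⇒fullProper (doneB full) proper = _ , full , proper
  BobLoses⇒fullProper (moveB (v , col , legal) next) proper =
    AliceWins⇒fullProper (next v col legal) (update-proper v col legal proper)

  colorOf : ∀ {κ} → Full κ → ∀ v → ∃[ col ] κ v ≡ just col
  colorOf {κ} full v with κ v in eq
  ... | just col = col , refl
  ... | nothing  = ⊥-elim (full v eq)

  -- One representative per part gives a clique of size `k`, whose colors are pairwise distinct.
  fullProper⇒k≤c : (∀ i → Fin (r i)) → ∀ {κ} → Full κ → Proper κ → k ≤ c
  fullProper⇒k≤c rep full proper = injective⇒≤ {f = color} injective
    where
    color : Fin k → Color
    color i = proj₁ (colorOf full (i , rep i))

    injective : ∀ {i j} → color i ≡ color j → i ≡ j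
    -- Adjacency is an inequality of parts, so properness only refutes `i ≢ j`; decidable equality
    -- removes the double negation.
    injective {i} {j} eq = decidable-stable (i ≟ᶠ j) λ i≢j →
      proper (i , rep i) (j , rep j) (color i) i≢j
        (proj₂ (colorOf full (i , rep i)))
        (trans (proj₂ (colorOf full (j , rep j))) (cong just (sym eq)))

  AliceWins⇒k≤c : (∀ i → Fin (r i)) → AliceWins empty → k ≤ c
  AliceWins⇒k≤c rep wins with AliceWins⇒fullProper wins empty-proper
  ... | _ , full , proper = fullProper⇒k≤c rep full proper

  -- The move itself witnesses that the rule of highest priority applies, so the strategy permits
  -- it. A winning strategy must survive every permitted move, hence one bad choice refutes it.
  firstRuleMove : ∀ R {Rs κ last} v col → Legal κ v col → R κ last v col →
    ¬ SBobLoses (byRules (R ∷ Rs)) (update κ v col) →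
    ¬ SWins (byRules (R ∷ Rs)) κ last
  firstRuleMove R v col (eq , _) rule lost (doneS full)   = full v eq
  firstRuleMove R v col legal    rule lost (moveS _ next) =
    lost (next v col legal (inj₁ ((v , col , legal , rule) , rule)))

  -- Legality is an implicit `True` argument, so at a concrete position it is settled by evaluation
  -- and a refutation reads as a list of moves.
  bobMove : ∀ {S κ} v col → {True (Legal? κ v col)} →
            ¬ SWins S (update κ v col) (just v) → ¬ SBobLoses S κ
  bobMove v col {legal} lost (doneSB full)   = full v (proj₁ (toWitness legal))
  bobMove v col {legal} lost (moveSB _ next) = lost (next v col (toWitness legal))

  bobStuck : ∀ {S κ} → {False (Full? κ)} → {False (LegalMove? κ)} → ¬ SBobLoses S κ
  bobStuck {_} {_} {¬full} {_}     (doneSB full)   = toWitnessFalse ¬full full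
  bobStuck {_} {_} {_}     {¬move} (moveSB move _) = toWitnessFalse ¬move move

  uncoloredPartMove : ∀ {Rs κ last} v col → {True (Legal? κ v col)} →
    {True (all? λ a → κ (part v , a) ≟C nothing)} → {True (NewColor? κ col)} →
    ¬ SBobLoses (byRules (ruleUncoloredPart ∷ Rs)) (update κ v col) →
    ¬ SWins (byRules (ruleUncoloredPart ∷ Rs)) κ last
  uncoloredPartMove v col {legal} {uncolored} {new} =
    firstRuleMove ruleUncoloredPart v col (toWitness legal)
      (toWitness uncolored , toWitness new)

  singletonMove : ∀ {Rs κ last} v col → r (part v) ≡ 1 →
    {True (Legal? κ v col)} → {True (NewColor? κ col)} →
    ¬ SBobLoses (byRules (ruleSingleton ∷ Rs)) (update κ v col) →
    ¬ SWins (byRules (ruleSingleton ∷ Rs)) κ last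
  singletonMove v col single {legal} {new} =
    firstRuleMove ruleSingleton v col (toWitness legal)
      (single , toWitness new)

sizes : Fin 5 → ℕ
sizes zero    = 2
sizes (suc _) = 1

sizes-positive : ∀ i → 1 ≤ sizes i
sizes-positive zero    = s≤s z≤n
sizes-positive (suc _) = s≤s z≤n

sizes-antitone : ∀ i j → i ≤ᶠ j → sizes j ≤ sizes i
sizes-antitone zero    zero    _ = ≤-refl
sizes-antitone zero    (suc _) _ = s≤s z≤n
sizes-antitone (suc _) (suc _) _ = ≤-refl

sizes-isPartSizes : IsPartSizes 5 sizes
sizes-isPartSizes =
  sizes-positive , sizes-antitone , λ { _ zero _ → ≤-refl }

sizes≢3 : ∀ j → sizes j ≢ 3
sizes≢3 zero    ()
sizes≢3 (suc _) ()

firstVertex : ∀ i → Fin (sizes i)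
firstVertex zero    = zero
firstVertex (suc _) = zero

open Game 5 sizes 5
open GameProperties 5 sizes 5

pattern x₁ = zero , zero
pattern x₂ = zero , suc zero
pattern s₁ = suc zero , zero
pattern s₂ = suc (suc zero) , zero
pattern s₃ = suc (suc (suc zero)) , zero

gameChromaticNumber : IsGameChromaticNumber 5 sizes 5
gameChromaticNumber =
  -- Six vertices make three rounds; Alice's replies are found by exhaustive search during type
  -- checking.
  winsInRounds⇒AliceWins 3 (toWitness {a? = winsInRounds? 3 empty} _) ,
  λ c c<5 wins → <⇒≱ c<5 (GameProperties.AliceWins⇒k≤c 5 sizes c firstVertex wins)

A1-loses : ¬ IsWinning A1
A1-loses =
  -- Bob spends a second color on the part that Alice opened; after three singletons all five colors
  -- are in use and the last singleton has none.
  uncoloredPartMove x₁ (# 0) (bobMove x₂ (# 1)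
  (uncoloredPartMove s₁ (# 2) (bobMove s₂ (# 3)
  (uncoloredPartMove s₃ (# 4) bobStuck))))

A1'-loses : ¬ IsWinning A1'
A1'-loses =
  -- The singleton rule keeps Alice away from the other vertex of the large part, which Bob then
  -- gives a second color.
  singletonMove s₁ (# 0) refl (bobMove x₁ (# 1)
  (singletonMove s₂ (# 2) refl (bobMove x₂ (# 3)
  (singletonMove s₃ (# 4) refl bobStuck))))

theorem2 : ∃[ k ] Σ (Fin k → ℕ) λ r → IsPartSizes k r × ∃[ c ]
    (IsGameChromaticNumber k r c
    × ¬ Game.IsWinning k r c (Game.A1 k r c)
    × ¬ Game.IsWinning k r c (Game.A1' k r c)
    × (∀ j → r j ≡ 3 →
    ¬ Game.IsWinning k r c (Game.A2 k r c j)
    × ¬ Game.IsWinning k r c (Game.A2' k r c j))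
    × (Odd (order k r) →
    ¬ Game.IsWinning k r c (Game.A3 k r c)
    × ¬ Game.IsWinning k r c (Game.A3' k r c)))
theorem2 =
  5 , sizes , sizes-isPartSizes , 5 , gameChromaticNumber , A1-loses , A1'-loses ,
  (λ j r≡3 → ⊥-elim (sizes≢3 j r≡3)) ,
  -- The order is 6, which is twice 3.
  (λ (m , 6≡odd) → ⊥-elim (even≢odd 3 m 6≡odd))
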